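{- Let $X$ be a finite set and $W=\{0,1\}^X$. For every $Y\subseteq X$, \[e^\Sigma_Y=\bigwedge_{0\leq k<|Y|}e^\Sigma_{Y,k_\leq},\] where the meet is taken in the lattice $E(W)$ of equivalence relations on $W$.
   Context: $E(W)$ is the complete lattice of equivalence relations on $W$ ordered by inclusion; meets are intersections, and the empty meet is $W\times W$. For $w\in W$ and $Y\subseteq X$, the sum-score of $w$ on $Y$ is $w_Y:=\sum_{y\in Y}w_y$. The relation $e^\Sigma_Y$ is the equivalence relation on $W$ given by $(w,u)\in e^\Sigma_Y$ iff $w_Y=u_Y$. For $0\leq k<|Y|$, $e^\Sigma_{Y,k_\leq}$ is the equivalence relation on $W$ corresponding to the two-block partition $\{\{w\in W\mid w_Y\leq k\},\{w\in W\mid w_Y>k\}\}$. -}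

module Defs where

open import Data.Fin using (Fin; toℕ)
open import Data.List using (List; map; filter; length; allFin)
open import Data.List.Properties using (map-cong)
open import Data.Nat using (ℕ; _≤_; _>_; _≤?_)
open import Data.Nat.ListAction using (sum)
open import Data.Nat.Properties using (<⇒≱; ≰⇒>)
open import Data.Product using (_×_; _,_)
open import Data.Sum using (_⊎_; inj₁; inj₂)
open import Function using (_↔_; Inverse; _∘_; id)
open import Level using (0ℓ; _⊔_) renaming (suc to lsuc)
open import Relation.Binary using (Rel; Setoid; Poset; IsEquivalence; _⇒_)
open import Relation.Binary.PropositionalEquality
  using (_≡_; _≗_; _→-setoid_; refl; sym; trans; cong; subst)
open import Relation.Nullary using (yes; no; contradiction)
open import Relation.Unary using (Pred; Decidable)
import Relation.Binary.Construct.Interior.Symmetric as SymInterior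

-- An equivalence relation on the set presented by a setoid has to respect
-- the setoid's equality; for an equivalence relation this amounts to
-- containing it.
record EquivalenceOn {c ℓ} (S : Setoid c ℓ) : Set (c ⊔ ℓ ⊔ lsuc 0ℓ) where
  open Setoid S using (Carrier; _≈_)
  field
    rel           : Rel Carrier 0ℓ
    isEquivalence : IsEquivalence rel
    respects      : _≈_ ⇒ rel

open EquivalenceOn public using (rel)

module _ {c ℓ} {S : Setoid c ℓ} where

  infix 4 _⊑_

  _⊑_ : Rel (EquivalenceOn S) c
  d ⊑ e = rel d ⇒ rel e

  ⋀ : {I : Set} → (I → EquivalenceOn S) → EquivalenceOn S
  ⋀ e = record
    { rel           = λ w u → ∀ i → rel (e i) w u
    ; isEquivalence = record
      { refl  = λ i → Eq.refl i
      ; sym   = λ p i → Eq.sym i (p i)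
      ; trans = λ p q i → Eq.trans i (p i) (q i)
      }
    ; respects      = λ w≈u i → EquivalenceOn.respects (e i) w≈u
    }
    where module Eq i = IsEquivalence (EquivalenceOn.isEquivalence (e i))

  ⋀-lower : {I : Set} (e : I → EquivalenceOn S) → ∀ i → ⋀ e ⊑ e i
  ⋀-lower e i p = p i

  ⋀-greatest : {I : Set} (e : I → EquivalenceOn S) (d : EquivalenceOn S) →
               (∀ i → d ⊑ e i) → d ⊑ ⋀ e
  ⋀-greatest e d d⊑e p i = d⊑e i p

-- Equality in this poset is mutual inclusion.
E : ∀ {c ℓ} → Setoid c ℓ → Poset _ _ _
E S = SymInterior.poset {R = _⊑_ {S = S}} id (λ p q → q ∘ p)

W : Set → Setoid 0ℓ 0ℓ
W X = X →-setoid Fin 2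

module _ {X : Set} {n : ℕ} (X↔Fin : X ↔ Fin n) {Y : Pred X 0ℓ} (Y? : Decidable Y) where

  -- Each element of Y is listed exactly once.
  elements : List X
  elements = filter Y? (map (Inverse.from X↔Fin) (allFin n))

  card : ℕ
  card = length elements

  sumScore : (X → Fin 2) → ℕ
  sumScore w = sum (map (toℕ ∘ w) elements)

  sumScore-cong : ∀ {w u} → w ≗ u → sumScore w ≡ sumScore u
  sumScore-cong w≗u = cong sum (map-cong (cong toℕ ∘ w≗u) elements)

  eΣ : EquivalenceOn (W X)
  eΣ = record
    { rel           = λ w u → sumScore w ≡ sumScore u
    ; isEquivalence = record { refl = refl ; sym = sym ; trans = trans }
    ; respects      = sumScore-cong
    }

  LowBlock HighBlock : ℕ → Pred (X → Fin 2) 0ℓ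
  LowBlock  k w = sumScore w ≤ k
  HighBlock k w = sumScore w > k

  eΣ≤ : ℕ → EquivalenceOn (W X)
  eΣ≤ k = record
    { rel           = SameBlock
    ; isEquivalence = record
      { refl  = λ {w} → same-score {w} {w} refl
      ; sym   = λ where
          (inj₁ (p , q)) → inj₁ (q , p)
          (inj₂ (p , q)) → inj₂ (q , p)
      ; trans = λ where
          (inj₁ (p , _)) (inj₁ (_ , r)) → inj₁ (p , r)
          (inj₁ (_ , q)) (inj₂ (r , _)) → contradiction q (<⇒≱ r)
          (inj₂ (_ , q)) (inj₁ (r , _)) → contradiction r (<⇒≱ q)
          (inj₂ (p , _)) (inj₂ (_ , r)) → inj₂ (p , r)
      }
    ; respects      = λ {w} {u} w≗u → same-score {w} {u} (sumScore-cong w≗u)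
    }
    where
    SameBlock : Rel (X → Fin 2) 0ℓ
    SameBlock w u = (LowBlock k w × LowBlock k u) ⊎ (HighBlock k w × HighBlock k u)

    same-score : ∀ {w u} → sumScore w ≡ sumScore u → SameBlock w u
    same-score {w} eq with sumScore w ≤? k
    ... | yes p = inj₁ (p , subst (_≤ k) eq p)
    ... | no ¬p = inj₂ (≰⇒> ¬p , subst (_> k) eq (≰⇒> ¬p))

{-# OPTIONS --safe #-}
-- Both scores are at most |Y|. If w_Y > u_Y, then k = u_Y is below |Y| and its
-- threshold separates w from u, so agreement at all thresholds forces w_Y = u_Y.
module Submission where

open import Defs
open import Data.Fin using (Fin; toℕ; fromℕ<)
open import Data.Fin.Properties using (toℕ-fromℕ<; toℕ≤pred[n])
open import Data.List using (List; []; _∷_; map; length)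
open import Data.Nat using (ℕ; _≤_; _>_; z≤n)
open import Data.Nat.ListAction using (sum)
open import Data.Nat.Properties
  using (≤-refl; ≤-trans; ≤-antisym; +-mono-≤; <⇒≱; <-≤-connex)
open import Data.Product using (_×_; _,_)
open import Data.Sum using (_⊎_; inj₁; inj₂)
open import Function using (_↔_; _∘_)
open import Level using (0ℓ)
open import Relation.Binary using (Poset; IsEquivalence)
open import Relation.Binary.PropositionalEquality using (subst)
open import Relation.Nullary using (contradiction)
open import Relation.Unary using (Pred; Decidable)
import Relation.Binary.Construct.Interior.Symmetric as SymInterior

-- The block of a vector at any threshold depends only on its score, so `eΣ` lies below every
-- `eΣ≤ k`, hence below their meet (`eΣ⊑eΣ≤`). Conversely, `thresholds⇒≤` recovers an inequality of
-- scores from agreement at the thresholds; symmetry of the meet and antisymmetry of `≤` turn it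
-- into equality.

sum-map≤length : {A : Set} (f : A → ℕ) → (∀ x → f x ≤ 1) →
                 ∀ xs → sum (map f xs) ≤ length xs
sum-map≤length f f≤1 []       = z≤n
sum-map≤length f f≤1 (x ∷ xs) = +-mono-≤ (f≤1 x) (sum-map≤length f f≤1 xs)

-- The decisive threshold is `b` itself, available only when `b < c`; otherwise the bound `a ≤ c`
-- already suffices.
thresholds⇒≤ : ∀ {a b c} → a ≤ c → (∀ (k : Fin c) → b ≤ toℕ k → a ≤ toℕ k) → a ≤ b
thresholds⇒≤ {a} {b} {c} a≤c h with <-≤-connex b c
... | inj₂ c≤b = ≤-trans a≤c c≤b
... | inj₁ b<c = subst (λ k → b ≤ k → a ≤ k) (toℕ-fromℕ< b<c) (h (fromℕ< b<c)) ≤-refl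

module _ {X : Set} {n : ℕ} (X↔Fin : X ↔ Fin n) {Y : Pred X 0ℓ} (Y? : Decidable Y) where

  private
    S : (X → Fin 2) → ℕ
    S = sumScore X↔Fin Y?

    thresholds : EquivalenceOn (W X)
    thresholds = ⋀ {I = Fin (card X↔Fin Y?)} (λ k → eΣ≤ X↔Fin Y? (toℕ k))

  sumScore≤card : ∀ w → S w ≤ card X↔Fin Y?
  -- Coordinates lie in `Fin 2`, so the bound `pred 2` computes to 1.
  sumScore≤card w = sum-map≤length (toℕ ∘ w) (toℕ≤pred[n] ∘ w) (elements X↔Fin Y?)

  eΣ⊑eΣ≤ : ∀ k → eΣ X↔Fin Y? ⊑ eΣ≤ X↔Fin Y? k
  eΣ⊑eΣ≤ k {w} {u} eq =
    -- Reflexivity puts `w` in its own block; only the second score is rewritten to `S u`.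
    subst (λ s → (S w ≤ k × s ≤ k) ⊎ (S w > k × s > k)) eq
          (IsEquivalence.refl (EquivalenceOn.isEquivalence (eΣ≤ X↔Fin Y? k)) {w})

  -- Supplies the hypothesis of `thresholds⇒≤` with `a = S w` and `b = S u`.
  eΣ≤⇒low : ∀ k {w u} → rel (eΣ≤ X↔Fin Y? k) w u → S u ≤ k → S w ≤ k
  eΣ≤⇒low k (inj₁ (w≤k , _)) _   = w≤k
  eΣ≤⇒low k (inj₂ (_ , u>k)) u≤k = contradiction u≤k (<⇒≱ u>k)

  thresholds⇒sumScore≤ : ∀ {w u} → rel thresholds w u → S w ≤ S u
  thresholds⇒sumScore≤ {w} {u} p =
    thresholds⇒≤ (sumScore≤card w) (λ k → eΣ≤⇒low (toℕ k) {w} {u} (p k))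

  ⋀eΣ≤⊑eΣ : thresholds ⊑ eΣ X↔Fin Y?
  ⋀eΣ≤⊑eΣ {w} {u} p = ≤-antisym
    (thresholds⇒sumScore≤ {w} {u} p)
    (thresholds⇒sumScore≤ {u} {w}
      (IsEquivalence.sym (EquivalenceOn.isEquivalence thresholds) {w} {u} p))

lemma16 : (X : Set) (n : ℕ) (X↔Fin : X ↔ Fin n) (Y : Pred X 0ℓ) (Y? : Decidable Y) →
    let open Poset (E (W X)) using (_≈_) in
    eΣ X↔Fin Y? ≈ ⋀ {I = Fin (card X↔Fin Y?)} (λ k → eΣ≤ X↔Fin Y? (toℕ k))
lemma16 X n X↔Fin Y Y? =
  (λ {w} {u} eq k → eΣ⊑eΣ≤ X↔Fin Y? (toℕ k) {w} {u} eq)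
  SymInterior.,
  (λ {w} {u} → ⋀eΣ≤⊑eΣ X↔Fin Y? {w} {u})
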